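{- Let $u$ be a countable transitive model of $\mathsf{ZF}$ minus Power Set, let $\mathbb P\in u$ be a partial order with ordering $\le^{\mathbb P}$ and least element $0^{\mathbb P}$, and let $I$ be a non-empty ideal on $\mathbb P$. Let $\mathcal M$ be the development model defined below and let $\tilde\in^{\mathcal M}=\{(\sigma,\tau)\in u^{\mathbb P}\times u^{\mathbb P}:\mathcal M\models\Diamond\Box\,\sigma\in^*\tau\}$. Then $\tilde\in^{\mathcal M}$ is well-founded on $u^{\mathbb P}$, and the Mostowski collapse $\mathrm{mos}$ of $\langle u^{\mathbb P},\tilde\in^{\mathcal M}\rangle$, defined by $\tilde\in^{\mathcal M}$-recursion as $\mathrm{mos}(\tau)=\{\mathrm{mos}(\sigma):\sigma\mathrel{\tilde\in}^{\mathcal M}\tau\}$, satisfies $\mathrm{mos}(\tau)=\mathrm{val}_I(\tau)$ for all $\tau\in u^{\mathbb P}$; consequently the collapsed structure $\langle\{\mathrm{mos}(\tau):\tau\in u^{\mathbb P}\},\in\rangle$ equals the forcing extension $u[I]$.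
   Context: A $\mathbb P$-name is (by $\in$-recursion) a set of ordered pairs $\langle\sigma,p\rangle$ with $\sigma$ a $\mathbb P$-name and $p\in\mathbb P$; $u^{\mathbb P}$ is the set of $\mathbb P$-names belonging to $u$. An ideal on $\mathbb P$ is a set $I\subseteq\mathbb P$ that is downward closed ($q\le^{\mathbb P}p\in I\Rightarrow q\in I$) and directed (any two elements of $I$ have a common upper bound in $I$). (This is the reverse of the usual forcing convention: $I$ plays the role of a filter.) By $\in$-recursion, $\mathrm{val}_I(\tau)=\{\mathrm{val}_I(\sigma):\exists q\in I\,\langle\sigma,q\rangle\in\tau\}$, and $u[I]=\langle\{\mathrm{val}_I(\sigma):\sigma\in u^{\mathbb P}\},\in\rangle$. The development model $\mathcal M$: states are the elements of $I$, the accessibility relation is $\le^{\mathbb P}$ restricted to $I$; at every state $s$ the structure has domain $u^{\mathbb P}$ with the (static) relation $\in$, and a dynamic binary relation $\in^*$ interpreted at $s$ by: $x\in^* y$ iff $x,y\in u^{\mathbb P}$ and there is $s'\le^{\mathbb P}s$ with $\langle x,s'\rangle\in y$. Modal semantics: $\Diamond\psi$ holds at $s$ iff $\psi$ holds at some state $t\ge s$, $\Box$ dually, and $\mathcal M\models\psi$ means $\psi$ holds at every state. -}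

module Defs where

open import Level using (0ℓ)
open import Data.Bool using (Bool; true; false; if_then_else_)
open import Data.Empty using (⊥)
open import Data.Fin using (Fin; zero; suc; lift)
open import Data.Fin.Patterns
open import Data.Nat using (ℕ; zero; suc; _+_)
open import Data.Product using (Σ; Σ-syntax; _×_; _,_; proj₁; proj₂)
open import Data.Sum using (_⊎_)
open import Data.Vec using (Vec; []; _∷_; lookup)
open import Function using (_∘_)
open import Function.Bundles using (Injection)
open import Induction.WellFounded using (WellFounded; Acc; acc)
open import Relation.Binary.Bundles using (Setoid)
open import Relation.Binary.Core using (Rel)
open import Relation.Binary.Definitions using (Minimum)
open import Relation.Binary.PropositionalEquality using (setoid)
open import Relation.Binary.Structures using (IsPartialOrder)
open import Relation.Unary using (Pred)

-- The ambient universe of sets is Aczel's type of iterative sets; set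
-- equality is the extensional equality _≈_, not _≡_.

data V : Set₁ where
  sup : (A : Set) → (A → V) → V

El : V → Set
El (sup A f) = A

infix 8 _!_
_!_ : (x : V) → El x → V
sup A f ! a = f a

infix 4 _≈_ _∈_ _⊆_

_≈_ : V → V → Set
sup A f ≈ sup B g =
  (∀ a → Σ[ b ∈ B ] f a ≈ g b) × (∀ b → Σ[ a ∈ A ] f a ≈ g b)

_∈_ : V → V → Set
x ∈ y = Σ[ j ∈ El y ] x ≈ y ! j

_⊆_ : V → V → Set
x ⊆ y = ∀ i → x ! i ∈ y

≈-refl : ∀ {x} → x ≈ x
≈-refl {sup A f} = (λ a → a , ≈-refl) , (λ a → a , ≈-refl)

≈-sym : ∀ {x y} → x ≈ y → y ≈ x
≈-sym {sup A f} {sup B g} (p , q) =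
  (λ b → proj₁ (q b) , ≈-sym (proj₂ (q b))) ,
  (λ a → proj₁ (p a) , ≈-sym (proj₂ (p a)))

≈-trans : ∀ {x y z} → x ≈ y → y ≈ z → x ≈ z
≈-trans {sup A f} {sup B g} {sup C h} (p , q) (r , s) =
  (λ a → let (b , e) = p a ; (c , d) = r b in c , ≈-trans e d) ,
  (λ c → let (b , d) = s c ; (a , e) = q b in a , ≈-trans e d)

elements : V → Setoid 0ℓ 0ℓ
elements x = record
  { Carrier       = El x
  ; _≈_           = λ i j → x ! i ≈ x ! j
  ; isEquivalence = record { refl = ≈-refl ; sym = ≈-sym ; trans = ≈-trans }
  }

⁅_,_⁆ : V → V → V
⁅ x , y ⁆ = sup Bool (λ b → if b then x else y)

-- Kuratowski pairs.
⟨_,_⟩ : V → V → V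
⟨ x , y ⟩ = ⁅ ⁅ x , x ⁆ , ⁅ x , y ⁆ ⁆

⋃ : V → V
⋃ (sup A f) = sup (Σ[ a ∈ A ] El (f a)) (λ (a , b) → f a ! b)

separate : (x : V) → (V → Set) → V
separate x Q = sup (Σ[ i ∈ El x ] Q (x ! i)) (λ (i , _) → x ! i)

_⊗_ : V → V → V
x ⊗ y = sup (El x × El y) (λ (i , j) → ⟨ x ! i , y ! j ⟩)

Transitive : V → Set
Transitive x = ∀ i → x ! i ⊆ x

Countable : V → Set
Countable x = Injection (elements x) (setoid ℕ)

-- The structure with domain D whose relation is ∈ restricted to D.
⟪_,∈⟫ : V → V
⟪ D ,∈⟫ =
  ⟨ D , sup (Σ[ i ∈ El D ] Σ[ j ∈ El D ] D ! i ∈ D ! j)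
            (λ (i , j , _) → ⟨ D ! i , D ! j ⟩) ⟩

infix  10 _∈′_ _≐_
infixr 8 _∧′_
infixr 7 _∨′_
infixr 6 _⇒′_
infix  5 _⇔′_

-- De Bruijn indices: variable 0F belongs to the innermost quantifier.
data Formula (n : ℕ) : Set where
  _∈′_ _≐_         : Fin n → Fin n → Formula n
  ⊥′               : Formula n
  _∧′_ _∨′_ _⇒′_   : Formula n → Formula n → Formula n
  ∀′ ∃′            : Formula (suc n) → Formula n

¬′_ : ∀ {n} → Formula n → Formula n
¬′ φ = φ ⇒′ ⊥′

_⇔′_ : ∀ {n} → Formula n → Formula n → Formula n
φ ⇔′ ψ = (φ ⇒′ ψ) ∧′ (ψ ⇒′ φ)

rename : ∀ {m n} → (Fin m → Fin n) → Formula m → Formula n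
rename ρ (x ∈′ y) = ρ x ∈′ ρ y
rename ρ (x ≐ y)  = ρ x ≐ ρ y
rename ρ ⊥′       = ⊥′
rename ρ (φ ∧′ ψ) = rename ρ φ ∧′ rename ρ ψ
rename ρ (φ ∨′ ψ) = rename ρ φ ∨′ rename ρ ψ
rename ρ (φ ⇒′ ψ) = rename ρ φ ⇒′ rename ρ ψ
rename ρ (∀′ φ)   = ∀′ (rename (lift 1 ρ) φ)
rename ρ (∃′ φ)   = ∃′ (rename (lift 1 ρ) φ)

∃!′ : ∀ {n} → Formula (suc n) → Formula n
∃!′ φ = ∃′ (φ ∧′ ∀′ (rename (lift 1 suc) φ ⇒′ 0F ≐ 1F))

universalClosure : ∀ {n} → Formula n → Formula 0
universalClosure {zero}  φ = φ
universalClosure {suc n} φ = universalClosure (∀′ φ)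

extensionality foundation pairing union infinity : Formula 0

extensionality = ∀′ (∀′ (∀′ (0F ∈′ 2F ⇔′ 0F ∈′ 1F) ⇒′ 1F ≐ 0F))

foundation =
  ∀′ (∃′ (0F ∈′ 1F) ⇒′ ∃′ (0F ∈′ 1F ∧′ ¬′ ∃′ (0F ∈′ 2F ∧′ 0F ∈′ 1F)))

pairing = ∀′ (∀′ (∃′ (∀′ (0F ∈′ 1F ⇔′ (0F ≐ 3F ∨′ 0F ≐ 2F)))))

union = ∀′ (∃′ (∀′ (0F ∈′ 1F ⇔′ ∃′ (0F ∈′ 3F ∧′ 1F ∈′ 0F))))

infinity =
  ∃′ (∃′ (0F ∈′ 1F ∧′ ∀′ (¬′ (0F ∈′ 1F))) ∧′
      ∀′ (0F ∈′ 1F ⇒′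
        ∃′ (0F ∈′ 2F ∧′ ∀′ (0F ∈′ 1F ⇔′ (0F ∈′ 2F ∨′ 0F ≐ 2F)))))

-- φ has variables z, x, followed by n parameters:
-- ∀ x ∃ y ∀ z (z ∈ y ⇔ z ∈ x ∧ φ(z, x)).
separation : ∀ {n} → Formula (2 + n) → Formula 0
separation φ = universalClosure
  (∀′ (∃′ (∀′ (0F ∈′ 1F ⇔′ (0F ∈′ 2F ∧′ rename (lift 1 suc) φ)))))

-- φ has variables y, x, a, followed by n parameters:
-- ∀ a ((∀ x ∈ a) ∃! y φ(y, x, a) ⇒ ∃ b ∀ y (y ∈ b ⇔ (∃ x ∈ a) φ(y, x, a))).
replacement : ∀ {n} → Formula (3 + n) → Formula 0
replacement {n} φ = universalClosure
  (∀′ (∀′ (0F ∈′ 1F ⇒′ ∃!′ φ) ⇒′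
       ∃′ (∀′ (0F ∈′ 1F ⇔′ ∃′ (0F ∈′ 3F ∧′ rename ρ φ)))))
  where
  ρ : Fin (3 + n) → Fin (4 + n)
  ρ 0F            = 1F
  ρ 1F            = 0F
  ρ (suc (suc i)) = suc (suc (suc i))

data ZF⁻ : Pred (Formula 0) 0ℓ where
  ext  : ZF⁻ extensionality
  fnd  : ZF⁻ foundation
  pair : ZF⁻ pairing
  un   : ZF⁻ union
  inf  : ZF⁻ infinity
  sep  : ∀ {n} (φ : Formula (2 + n)) → ZF⁻ (separation φ)
  repl : ∀ {n} (φ : Formula (3 + n)) → ZF⁻ (replacement φ)

-- Connectives are read as in Agda; under excluded middle this is Tarski's
-- satisfaction.
Sat : (u : V) → ∀ {n} → Vec (El u) n → Formula n → Set
Sat u ρ (x ∈′ y) = u ! lookup ρ x ∈ u ! lookup ρ y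
Sat u ρ (x ≐ y)  = u ! lookup ρ x ≈ u ! lookup ρ y
Sat u ρ ⊥′       = ⊥
Sat u ρ (φ ∧′ ψ) = Sat u ρ φ × Sat u ρ ψ
Sat u ρ (φ ∨′ ψ) = Sat u ρ φ ⊎ Sat u ρ ψ
Sat u ρ (φ ⇒′ ψ) = Sat u ρ φ → Sat u ρ ψ
Sat u ρ (∀′ φ)   = ∀ a → Sat u (a ∷ ρ) φ
Sat u ρ (∃′ φ)   = Σ[ a ∈ El u ] Sat u (a ∷ ρ) φ

_IsModelOf_ : V → Pred (Formula 0) 0ℓ → Set
u IsModelOf T = ∀ φ → T φ → Sat u [] φ

record PartialOrder : Set₁ where
  field
    carrier order : V
    order⊆        : order ⊆ carrier ⊗ carrier

  infix 4 _≤_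
  _≤_ : V → V → Set
  p ≤ q = ⟨ p , q ⟩ ∈ order

  _≤ᴱ_ : Rel (El carrier) 0ℓ
  i ≤ᴱ j = carrier ! i ≤ carrier ! j

  field
    isPartialOrder : IsPartialOrder (Setoid._≈_ (elements carrier)) _≤ᴱ_
    least          : El carrier
    least-minimum  : Minimum _≤ᴱ_ least

  asSet : V
  asSet = ⟨ carrier , order ⟩

open PartialOrder using (carrier; asSet)

record IsIdeal (ℙ : PartialOrder) (I : V) : Set where
  open PartialOrder ℙ using (_≤_; _≤ᴱ_)
  field
    subset     : I ⊆ carrier ℙ
    downClosed : ∀ q p → q ≤ᴱ p → carrier ℙ ! p ∈ I → carrier ℙ ! q ∈ I
    directed   : ∀ i j → Σ[ k ∈ El I ] (I ! i ≤ I ! k) × (I ! j ≤ I ! k)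

-- Every element of τ is a pair ⟨ σ , p ⟩ with σ a name and p ∈ P.  The first
-- component of a Kuratowski pair x is an element of ⋃ x, so σ may be taken to
-- range over ⋃ x; this keeps IsName in Set, as separation requires.
data IsName (P τ : V) : Set where
  isName :
    (∀ i → Σ[ s ∈ El (⋃ (τ ! i)) ] Σ[ p ∈ El P ]
             τ ! i ≈ ⟨ ⋃ (τ ! i) ! s , P ! p ⟩ × IsName P (⋃ (τ ! i) ! s)) →
    IsName P τ

names : V → PartialOrder → V
names u ℙ = separate u (IsName (carrier ℙ))

-- val I τ = { val I σ : ∃ q ∈ I, ⟨ σ , q ⟩ ∈ τ }, with σ again ranging over
-- ⋃ x for x ∈ τ.  Definitionally val⋃ I x s is val I (⋃ x ! s) once x and its
-- elements are in the form sup A f; the detour exhibits structural recursion.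
val  : V → V → V
val⋃ : V → (x : V) → El (⋃ x) → V
val∈ : V → (x : V) → El x → V

val I (sup A f) =
  sup (Σ[ a ∈ A ] Σ[ s ∈ El (⋃ (f a)) ] Σ[ q ∈ El I ]
         f a ≈ ⟨ ⋃ (f a) ! s , I ! q ⟩)
      (λ (a , s , _) → val⋃ I (f a) s)

val⋃ I (sup B g) (b , c) = val∈ I (g b) c

val∈ I (sup C h) c = val I (h c)

_[_,_] : V → PartialOrder → V → V
u [ ℙ , I ] = ⟪ sup (El (names u ℙ)) (λ σ → val I (names u ℙ ! σ)) ,∈⟫

-- Constant-domain Kripke structures with a static relation ∈ and a dynamic
-- relation ∈*.
record KripkeStructure : Set₁ where
  field
    State  : Set
    _⊑_    : Rel State 0ℓ
    Domain : Set
    equal  : Rel Domain 0ℓ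
    static : Rel Domain 0ℓ
    dynamic : State → Rel Domain 0ℓ

data ModalFormula (n : ℕ) : Set where
  _∈ᵐ_ _∈*ᵐ_ _≐ᵐ_    : Fin n → Fin n → ModalFormula n
  ⊥ᵐ                 : ModalFormula n
  _∧ᵐ_ _∨ᵐ_ _⇒ᵐ_     : ModalFormula n → ModalFormula n → ModalFormula n
  ∀ᵐ ∃ᵐ              : ModalFormula (suc n) → ModalFormula n
  ◇ □                : ModalFormula n → ModalFormula n

module _ (M : KripkeStructure) where
  open KripkeStructure M

  Holds : ∀ {n} → State → Vec Domain n → ModalFormula n → Set
  Holds s ρ (x ∈ᵐ y)  = static (lookup ρ x) (lookup ρ y)
  Holds s ρ (x ∈*ᵐ y) = dynamic s (lookup ρ x) (lookup ρ y)
  Holds s ρ (x ≐ᵐ y)  = equal (lookup ρ x) (lookup ρ y)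
  Holds s ρ ⊥ᵐ        = ⊥
  Holds s ρ (φ ∧ᵐ ψ)  = Holds s ρ φ × Holds s ρ ψ
  Holds s ρ (φ ∨ᵐ ψ)  = Holds s ρ φ ⊎ Holds s ρ ψ
  Holds s ρ (φ ⇒ᵐ ψ)  = Holds s ρ φ → Holds s ρ ψ
  Holds s ρ (∀ᵐ φ)    = ∀ a → Holds s (a ∷ ρ) φ
  Holds s ρ (∃ᵐ φ)    = Σ[ a ∈ Domain ] Holds s (a ∷ ρ) φ
  Holds s ρ (◇ φ)     = Σ[ t ∈ State ] s ⊑ t × Holds t ρ φ
  Holds s ρ (□ φ)     = ∀ t → s ⊑ t → Holds t ρ φ

  Valid : ∀ {n} → Vec Domain n → ModalFormula n → Set
  Valid ρ φ = ∀ s → Holds s ρ φ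

developmentModel : V → PartialOrder → V → KripkeStructure
developmentModel u ℙ I = record
  { State   = El I
  ; _⊑_     = λ s t → I ! s ≤ I ! t
  ; Domain  = El N
  ; equal   = λ x y → N ! x ≈ N ! y
  ; static  = λ x y → N ! x ∈ N ! y
  ; dynamic = λ s x y → Σ[ s′ ∈ El (carrier ℙ) ]
      (carrier ℙ ! s′ ≤ I ! s) × ⟨ N ! x , carrier ℙ ! s′ ⟩ ∈ N ! y
  }
  where
  open PartialOrder ℙ using (_≤_)
  N = names u ℙ

∈̃ : (u : V) (ℙ : PartialOrder) (I : V) → Rel (El (names u ℙ)) 0ℓ
∈̃ u ℙ I σ τ = Valid (developmentModel u ℙ I) (σ ∷ τ ∷ []) (◇ (□ (0F ∈*ᵐ 1F)))

module _ {A : Set} {R : Rel A 0ℓ} where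

  mosAcc : ∀ x → Acc R x → V
  mosAcc x (acc rs) = sup (Σ[ y ∈ A ] R y x) (λ (y , r) → mosAcc y (rs r))

  -- mos wf x = { mos wf y : R y x }
  mos : WellFounded R → A → V
  mos wf x = mosAcc x (wf x)

  collapse : WellFounded R → V
  collapse wf = ⟪ sup A (mos wf) ,∈⟫

{-# OPTIONS --safe #-}
module Submission where

-- Down-closure and directedness of I, with I inhabited, make ◇□(σ ∈* τ)
-- equivalent to ⟨ σ , q ⟩ ∈ τ for some q ∈ I.  Since then σ ∈ ⁅ σ , σ ⁆ ∈
-- ⟨ σ , q ⟩ ∈ τ, the relation ∈̃ is contained in the transitive closure of ∈,
-- and the two recursions defining mos and val have the same clauses.

open import Defs
open import Data.Bool using (true; false)
open import Data.Product using (Σ-syntax; _×_; _,_; proj₁; proj₂)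
open import Function using (_on_)
open import Induction.WellFounded using (WellFounded; Acc; acc; module Subrelation)
import Relation.Binary.Construct.Closure.Transitive as Plus
open Plus using (TransClosure; _∷_)
import Relation.Binary.Construct.On as On
open import Relation.Binary.PropositionalEquality using (_≡_; refl)
open import Relation.Binary.Structures using (IsPartialOrder)

≡⇒≈ : ∀ {x y} → x ≡ y → x ≈ y
≡⇒≈ refl = ≈-refl

!∈ : ∀ x i → x ! i ∈ x
!∈ x i = i , ≈-refl

∈-respˡ : ∀ {x y} z → x ≈ y → x ∈ z → y ∈ z
∈-respˡ _ e (j , e′) = j , ≈-trans (≈-sym e) e′

∈-respʳ : ∀ {x} y z → y ≈ z → x ∈ y → x ∈ z
∈-respʳ (sup _ _) (sup _ _) (p , _) (j , e) =
  let (k , e′) = p j in k , ≈-trans e e′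

⊆-antisym : ∀ {x y} → x ⊆ y → y ⊆ x → x ≈ y
⊆-antisym {sup _ _} {sup _ _} p q =
  p , λ b → let (a , e) = q b in a , ≈-sym e

⁅,⁆-cong : ∀ {x x′ y y′} → x ≈ x′ → y ≈ y′ → ⁅ x , y ⁆ ≈ ⁅ x′ , y′ ⁆
⁅,⁆-cong e e′ =
  (λ { true → true , e ; false → false , e′ }) ,
  (λ { true → true , e ; false → false , e′ })

⟨,⟩-cong : ∀ {x x′ y y′} → x ≈ x′ → y ≈ y′ → ⟨ x , y ⟩ ≈ ⟨ x′ , y′ ⟩
⟨,⟩-cong e e′ = ⁅,⁆-cong (⁅,⁆-cong e e) (⁅,⁆-cong e e′)

-- Whichever member of the second pair matches `⁅ x , x ⁆`, it contains `x′`, and every member of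
-- `⁅ x , x ⁆` is `x`.
⟨,⟩-injectiveˡ : ∀ {x x′ y y′} → ⟨ x , y ⟩ ≈ ⟨ x′ , y′ ⟩ → x ≈ x′
⟨,⟩-injectiveˡ (p , _) with p true
... | true  , _ , q with q true
...   | true  , e = e
...   | false , e = e
⟨,⟩-injectiveˡ (p , _) | false , _ , q with q true
...   | true  , e = e
...   | false , e = e

∈-⋃ : ∀ {x} y z → x ∈ y → y ∈ z → x ∈ ⋃ z
∈-⋃ y (sup B g) x∈y (b , e) =
  let (c , e′) = ∈-respʳ y (g b) e x∈y in (b , c) , e′

fst∈⋃ : ∀ {x y} z → ⟨ x , y ⟩ ≈ z → x ∈ ⋃ z
fst∈⋃ {x} {y} z e =
  ∈-⋃ ⁅ x , x ⁆ z (!∈ ⁅ x , x ⁆ true) (∈-respʳ ⟨ x , y ⟩ z e (!∈ ⟨ x , y ⟩ true))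

∈-trans : ∀ {x} u y → Transitive u → x ∈ y → y ∈ u → x ∈ u
∈-trans u y trans x∈y (k , e) =
  let (l , e′) = ∈-respʳ y (u ! k) e x∈y in ∈-respˡ u (≈-sym e′) (trans k l)

∈-wellFounded : WellFounded _∈_
∈-wellFounded x = accessible x ≈-refl
  where
  -- Generalised to every `y ≈ x`, since a member of `sup A f` is only `≈` to some subtree `f a`;
  -- the recursion is on `x`.
  accessible : ∀ x {y} → y ≈ x → Acc _∈_ y
  accessible (sup A f) {y} e = acc λ z∈y →
    let (a , e′) = ∈-respʳ y (sup A f) e z∈y in accessible (f a) e′

fst-∈⁺ : ∀ {x y z} → ⟨ x , y ⟩ ∈ z → TransClosure _∈_ x z
fst-∈⁺ {x} {y} p = !∈ ⁅ x , x ⁆ true ∷ !∈ ⟨ x , y ⟩ true ∷ Plus.[ p ]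

-- For the last claim: the collapse and `u [ ℙ , I ]` are families over the same index type, the
-- names in `u`.
⟪,∈⟫-cong : ∀ {A : Set} {f g : A → V} → (∀ a → f a ≈ g a) →
            ⟪ sup A f ,∈⟫ ≈ ⟪ sup A g ,∈⟫
⟪,∈⟫-cong {A} {f} {g} e = ⟨,⟩-cong
  ((λ a → a , e a) , (λ a → a , e a))
  ( (λ (i , j , m) → (i , j , ∈-respˡ (g j) (e i) (∈-respʳ (f j) (g j) (e j) m)) , ⟨,⟩-cong (e i) (e j))
  , (λ (i , j , m) → (i , j , ∈-respˡ (f j) (≈-sym (e i)) (∈-respʳ (g j) (f j) (≈-sym (e j)) m)) ,
                     ⟨,⟩-cong (e i) (e j)))

IsName-resp : ∀ {P x y} → x ≈ y → IsName P x → IsName P y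
IsName-resp {x = x} {y} e (isName h) = isName λ i →
  let (j , yi≈xj)        = ∈-respʳ y x (≈-sym e) (!∈ y i)
      (s , p , xj≈ , nm) = h j
      yi≈                = ≈-trans yi≈xj xj≈
      -- The index `s` points into `⋃ (x ! j)`, so the first component has to be located afresh in
      -- `⋃ (y ! i)`.
      (s′ , s≈s′)        = fst∈⋃ (y ! i) (≈-sym yi≈)
  in s′ , p , ≈-trans yi≈ (⟨,⟩-cong s≈s′ ≈-refl) , IsName-resp s≈s′ nm

IsName-fst : ∀ {P x y z} → ⟨ x , y ⟩ ∈ z → IsName P z → IsName P x
IsName-fst (j , e) (isName h) =
  let (_ , _ , e′ , nm) = h j
  in IsName-resp (≈-sym (⟨,⟩-injectiveˡ (≈-trans e e′))) nm

-- Transitivity of `u` is applied down the chain from `τ` through the pair and `⁅ x , x ⁆` to `x`.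
-- Thus `mos`, which ranges over names in `u` only, misses no member of `val I τ`.
fst∈names : ∀ {u ℙ x y} → Transitive u → ∀ τ →
            ⟨ x , y ⟩ ∈ names u ℙ ! τ → x ∈ names u ℙ
fst∈names {u} {ℙ} {x} {y} trans (k , nm) m =
  let x∈u = ∈-trans u ⁅ x , x ⁆ trans (!∈ ⁅ x , x ⁆ true)
              (∈-trans u ⟨ x , y ⟩ trans (!∈ ⟨ x , y ⟩ true)
                (∈-trans u (u ! k) trans m (!∈ u k)))
      (l , e) = x∈u
  in (l , IsName-resp e (IsName-fst m nm)) , e

val∈≡val : ∀ I x c → val∈ I x c ≡ val I (x ! c)
val∈≡val I (sup _ _) c = refl

val⋃≡val : ∀ I x s → val⋃ I x s ≡ val I (⋃ x ! s)
val⋃≡val I (sup B g) (b , c) = val∈≡val I (g b) c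

-- Up to ≈ in the name σ, so that val need not be known to respect ≈.
val-intro : ∀ {I σ} τ q → ⟨ σ , I ! q ⟩ ∈ τ →
            Σ[ σ′ ∈ V ] (σ ≈ σ′) × (val I σ′ ∈ val I τ)
val-intro {I} (sup A f) q (a , e) =
  let (s , σ≈s) = fst∈⋃ (f a) e
  in ⋃ (f a) ! s , σ≈s ,
     (a , s , q , ≈-trans (≈-sym e) (⟨,⟩-cong σ≈s ≈-refl)) ,
     ≈-sym (≡⇒≈ (val⋃≡val I (f a) s))

val-elim : ∀ {I} τ j → Σ[ σ ∈ V ] Σ[ q ∈ El I ]
           (⟨ σ , I ! q ⟩ ∈ τ) × (val I τ ! j ≈ val I σ)
val-elim {I} (sup A f) (a , s , q , e) =
  ⋃ (f a) ! s , q , (a , ≈-sym e) , ≡⇒≈ (val⋃≡val I (f a) s)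

module _ (u : V) (ℙ : PartialOrder) (I : V) (ideal : IsIdeal ℙ I) where
  open PartialOrder ℙ
  open IsIdeal ideal
  open IsPartialOrder isPartialOrder renaming (refl to ≤ᴱ-refl; trans to ≤ᴱ-trans)

  ≤-resp : ∀ {p p′ q q′} → p ≈ p′ → q ≈ q′ → p ≤ q → p′ ≤ q′
  ≤-resp e e′ = ∈-respˡ order (⟨,⟩-cong e e′)

  ⊑-refl : ∀ t → I ! t ≤ I ! t
  ⊑-refl t = let (p , e) = subset t in ≤-resp (≈-sym e) (≈-sym e) (≤ᴱ-refl {p})

  ⊑-trans : ∀ {r s t} → I ! r ≤ I ! s → I ! s ≤ I ! t → I ! r ≤ I ! t
  ⊑-trans {r} {s} {t} r≤s s≤t =
    let (p , r≈p) = subset r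
        (q , s≈q) = subset s
        (o , t≈o) = subset t
    in ≤-resp (≈-sym r≈p) (≈-sym t≈o)
         (≤ᴱ-trans {p} {q} {o} (≤-resp r≈p s≈q r≤s) (≤-resp s≈q t≈o s≤t))

  below∈I : ∀ {p t} → carrier ! p ≤ I ! t → carrier ! p ∈ I
  below∈I {p} {t} p≤t =
    let (r , t≈r) = subset t
    in downClosed p r (≤-resp ≈-refl t≈r p≤t) (∈-respˡ I t≈r (!∈ I t))

  -- The state `s₀` keeps validity from being vacuous. Evaluating the box at `t` itself gives a
  -- condition below `t`, which lies in `I` by down-closure.
  ∈̃⇒pair∈ : El I → ∀ {σ τ} → ∈̃ u ℙ I σ τ →
            Σ[ q ∈ El I ] ⟨ names u ℙ ! σ , I ! q ⟩ ∈ names u ℙ ! τ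
  ∈̃⇒pair∈ s₀ {τ = τ} h =
    let (t , _ , always) = h s₀
        (p , p≤t , m)    = always t (⊑-refl t)
        (q , p≈q)        = below∈I {p} {t} p≤t
    in q , ∈-respˡ (names u ℙ ! τ) (⟨,⟩-cong ≈-refl p≈q) m

  -- Directedness gives a state `t` above both `s` and `q`; at every state from `t` on, `q` itself
  -- witnesses `∈*`.
  pair∈⇒∈̃ : ∀ {σ τ} q → ⟨ names u ℙ ! σ , I ! q ⟩ ∈ names u ℙ ! τ → ∈̃ u ℙ I σ τ
  pair∈⇒∈̃ {τ = τ} q m s =
    let (t , s≤t , q≤t) = directed s q
        (p , q≈p)       = subset q
    in t , s≤t , λ t′ t≤t′ →
         p , ≤-resp q≈p ≈-refl (⊑-trans {q} {t} {t′} q≤t t≤t′) ,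
         ∈-respˡ (names u ℙ ! τ) (⟨,⟩-cong ≈-refl q≈p) m

  ∈̃-wellFounded : El I → WellFounded (∈̃ u ℙ I)
  ∈̃-wellFounded s₀ = Subrelation.wellFounded
    {_<₁_ = ∈̃ u ℙ I} {_<₂_ = TransClosure _∈_ on (names u ℙ !_)}
    (λ {σ} {τ} h → fst-∈⁺ (proj₂ (∈̃⇒pair∈ s₀ {σ} {τ} h)))
    (On.wellFounded (names u ℙ !_) (Plus.wellFounded _∈_ ∈-wellFounded))

  -- Induction on the accessibility proof. The set `x` is left free because `val-intro` returns a
  -- name only `≈` to the given one.
  mosAcc≈val : Transitive u → El I → ∀ τ (a : Acc (∈̃ u ℙ I) τ) {x} →
               names u ℙ ! τ ≈ x → mosAcc τ a ≈ val I x
  mosAcc≈val trans s₀ τ (acc rs) {x} τ≈x = ⊆-antisym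
    (λ (σ , h) →
      let (q , m)          = ∈̃⇒pair∈ s₀ {σ} {τ} h
          (_ , σ≈σ′ , val∈x) = val-intro x q (∈-respʳ (names u ℙ ! τ) x τ≈x m)
      in ∈-respˡ (val I x) (≈-sym (mosAcc≈val trans s₀ σ (rs h) σ≈σ′)) val∈x)
    (λ j →
      let (_ , q , m , e) = val-elim x j
          -- The name supplied by `val-elim` is an arbitrary set; it is replaced by an `≈` one
          -- indexed in `names u ℙ`, so that `∈̃` applies.
          m′              = ∈-respʳ x (names u ℙ ! τ) (≈-sym τ≈x) m
          (σ , σ′≈σ)      = fst∈names {u} {ℙ} trans τ m′
          h               = pair∈⇒∈̃ {σ} {τ} q (∈-respˡ (names u ℙ ! τ) (⟨,⟩-cong σ′≈σ ≈-refl) m′)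
      in (σ , h) ,
         ≈-trans e (≈-sym (mosAcc≈val trans s₀ σ (rs h) (≈-sym σ′≈σ))))

mainTheorem5 : (u : V) → Countable u → Transitive u → u IsModelOf ZF⁻ →
    (ℙ : PartialOrder) → PartialOrder.asSet ℙ ∈ u →
    (I : V) → IsIdeal ℙ I → El I →
    Σ[ wf ∈ WellFounded (∈̃ u ℙ I) ]
    (∀ τ → mos wf τ ≈ val I (names u ℙ ! τ)) ×
    collapse wf ≈ u [ ℙ , I ]
mainTheorem5 u _ trans _ ℙ _ I ideal s₀ = wf , mos≈val , ⟪,∈⟫-cong mos≈val
  where
  wf : WellFounded (∈̃ u ℙ I)
  wf = ∈̃-wellFounded u ℙ I ideal s₀

  mos≈val : ∀ τ → mos wf τ ≈ val I (names u ℙ ! τ)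
  mos≈val τ = mosAcc≈val u ℙ I ideal trans s₀ τ (wf τ) ≈-refl
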